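{- Let $(A,\mathit{Con},\mid\!\sim)$ be a cumulative nonmonotonic system. Then there is a normal default structure $(B,\mathit{Con}^*,\Delta)$ (with trivial entailment) such that: (1) $B\supseteq A$; (2) for every $X\subseteq B$, $X\in\mathit{Con}$ if and only if $X\subseteq A$ and $X\in\mathit{Con}^*$; (3) for all $X,Y\in\mathit{Con}$, $X\mid\!\sim Y$ if and only if $X\mid\!\sim_B Y$, where $\mid\!\sim_B$ is the skeptical nonmonotonic consequence relation of $(B,\mathit{Con}^*,\Delta)$; (4) every information state (consistent subset) of $B$ has a unique extension in $(B,\mathit{Con}^*,\Delta)$.
   Context: An abstract nonmonotonic system is a triple $(A,\mathit{Con},\mid\!\sim)$ where $\mathit{Con}$ is a collection of finite subsets of $A$ and $\mid\!\sim\ \subseteq\mathit{Con}\times\mathit{Con}$, satisfying: (1) $X\subseteq Y\in\mathit{Con}\Rightarrow X\in\mathit{Con}$; (2) $a\in A\Rightarrow\{a\}\in\mathit{Con}$; (3) $X\mid\!\sim T\Rightarrow X\cup T\in\mathit{Con}$; (4) $Y\subseteq X\Rightarrow X\mid\!\sim Y$; (5) $X\mid\!\sim T$ and $T\cup X\mid\!\sim Y$ imply $X\mid\!\sim Y$; (6) $X\mid\!\sim Y$ and $X\mid\!\sim Z$ imply $X\mid\!\sim Y\cup Z$. It is cumulative if it also satisfies cautious monotony: $X\mid\!\sim\{a\}$ and $X\mid\!\sim\{b\}$ imply $X\cup\{a\}\mid\!\sim\{b\}$. A normal default structure (with trivial entailment) is a triple $(B,\mathit{Con}^*,\Delta)$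 where $B$ is a set of tokens; $\mathit{Con}^*$ is a set of finite subsets of $B$ with $\emptyset\in\mathit{Con}^*$, closed under subsets, and containing $\{b\}$ for each $b\in B$; an arbitrary subset of $B$ is consistent (an information state) if all its finite subsets are in $\mathit{Con}^*$; $\Delta$ is a set of normal defaults $\frac{X:a}{a}$ with $X\in\mathit{Con}^*$ and $a\in B$. For consistent $x\subseteq B$ and $S\subseteq B$: $\phi(x,S,0)=x$, $\phi(x,S,i+1)=\phi(x,S,i)\cup\{a\mid\frac{X:a}{a}\in\Delta,\ X\subseteq\phi(x,S,i),\ \{a\}\cup S\text{ consistent}\}$, $\Phi(x,S)=\bigcup_i\phi(x,S,i)$; $y$ is an extension of $x$ if $\Phi(x,y)=y$. The skeptical relation: for $X\in\mathit{Con}^*$ and finite $Y\subseteq B$, $X\mid\!\sim_B Y$ iff every element of $Y$ belongs to every extension of $X$.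
   Formalization: It is additionally assumed that Con is a nonempty collection; this excludes only the system with A = ∅ and Con = ∅, for which clause (2) fails at X = ∅ because ∅ always belongs to Con*. -}

module Defs where

open import Level using (Level; suc)
open import Data.List.Base using (List; []; _++_; [_])
open import Data.List.Membership.Propositional using (_∈_)
open import Data.List.Relation.Unary.All using (All)
open import Data.List.Relation.Binary.Subset.Propositional using () renaming (_⊆_ to _⊆ˡ_)
open import Data.Nat.Base using (ℕ; zero) renaming (suc to 1+_)
open import Data.Product.Base using (∃; _×_)
open import Relation.Unary using (Pred; _≐_; _∪_; ｛_｝)

-- Finite subsets are represented by lists, regarded up to having the same
-- members; union is _++_.  Arbitrary subsets are predicates, compared by _≐_.

infix 4 _≈ˡ_

_≈ˡ_ : ∀ {a} {A : Set a} → List A → List A → Set a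
X ≈ˡ Y = X ⊆ˡ Y × Y ⊆ˡ X

⟦_⟧ : ∀ {a} {A : Set a} → List A → Pred A a
⟦ X ⟧ = _∈ X

-- The arbitrary subset P is one of the finite sets in the collection C.
_belongsTo_ : ∀ {a} {A : Set a} → Pred A a → (List A → Set a) → Set a
P belongsTo C = ∃ λ X → C X × P ≐ ⟦ X ⟧

record NonmonotonicSystem (ℓ : Level) : Set (suc ℓ) where
  infix 4 _∣~_
  field
    A    : Set ℓ
    Con  : List A → Set ℓ
    _∣~_ : List A → List A → Set ℓ

    -- _∣~_ is a relation between members of Con, and depends only on the
    -- sets its arguments represent (for Con the latter follows from con-⊆).
    ∣~-con  : ∀ {X Y} → X ∣~ Y → Con X × Con Y
    ∣~-resp : ∀ {X X′ Y Y′} → X ≈ˡ X′ → Y ≈ˡ Y′ → X ∣~ Y → X′ ∣~ Y′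

    con-⊆    : ∀ {X Y} → X ⊆ˡ Y → Con Y → Con X
    con-[_]  : ∀ a → Con [ a ]
    ∣~-∪-con : ∀ {X T} → X ∣~ T → Con (X ++ T)
    ∣~-refl  : ∀ {X Y} → Con X → Y ⊆ˡ X → X ∣~ Y
    ∣~-cut   : ∀ {X T Y} → X ∣~ T → T ++ X ∣~ Y → X ∣~ Y
    ∣~-∪     : ∀ {X Y Z} → X ∣~ Y → X ∣~ Z → X ∣~ Y ++ Z

Cumulative : ∀ {ℓ} → NonmonotonicSystem ℓ → Set ℓ
Cumulative N = ∀ {X a b} → X ∣~ [ a ] → X ∣~ [ b ] → X ++ [ a ] ∣~ [ b ]
  where open NonmonotonicSystem N

record NormalDefaultStructure (ℓ : Level) : Set (suc ℓ) where
  field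
    B    : Set ℓ
    Con* : List B → Set ℓ
    -- Δ X a : the normal default  X : a / a  belongs to the structure.
    Δ    : List B → B → Set ℓ

    con*-∅   : Con* []
    con*-⊆   : ∀ {X Y} → X ⊆ˡ Y → Con* Y → Con* X
    con*-[_] : ∀ b → Con* [ b ]
    Δ-con*   : ∀ {X a} → Δ X a → Con* X

  Consistent : Pred B ℓ → Set ℓ
  Consistent x = ∀ F → All x F → Con* F

  φ : Pred B ℓ → Pred B ℓ → ℕ → Pred B ℓ
  φ x S zero   = x
  φ x S (1+ i) = φ x S i ∪
    (λ a → ∃ λ X → Δ X a × All (φ x S i) X × Consistent (｛ a ｝ ∪ S))

  Φ : Pred B ℓ → Pred B ℓ → Pred B ℓ
  Φ x S b = ∃ λ i → φ x S i b

  _IsExtensionOf_ : Pred B ℓ → Pred B ℓ → Set ℓ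
  y IsExtensionOf x = Φ x y ≐ y

  HasUniqueExtension : Pred B ℓ → Set (suc ℓ)
  HasUniqueExtension x = ∃ λ y →
    y IsExtensionOf x × (∀ z → z IsExtensionOf x → z ≐ y)

  -- Skeptical consequence, a relation with domain Con*.
  infix 4 _∣~ᴮ_
  _∣~ᴮ_ : List B → List B → Set (suc ℓ)
  X ∣~ᴮ Y = Con* X × (∀ y → y IsExtensionOf ⟦ X ⟧ → All y Y)

-- To the tokens of A we add one token ⟨ Z ⟩ for each Z ∈ Con, read "the
-- information available is exactly that of Z".  Let E Z consist of the a with
-- Z ∣~ a and of the ⟨ W ⟩ with W ∼ Z, i.e. W ∣~ Z and Z ∣~ W; by cumulativity
-- equivalent sets have the same E.  A finite set is consistent when it lies in
-- some E Z, and the defaults are  Z : ⟨ Z ⟩  and  ⟨ Z ⟩ : b  for b ∈ E Z.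
-- Since ⟨ Z ⟩ is consistent only with subsets of E Z, a nonmonotonic conclusion
-- of Z is blocked as soon as the state is not contained in E Z.  The unique
-- extension of a state x is E Z if x lies in E Z for some Z which is contained
-- in x or satisfies ⟨ Z ⟩ ∈ x, and x itself if there is no such Z; taking the
-- union of x with all such E Z covers both cases without deciding between them.
module Submission where

open import Defs
open import Data.List.Base using (List; []; _∷_; [_]; _++_; map)
open import Data.List.Membership.Propositional.Properties using (∈-map⁻)
open import Data.List.Properties using (++-assoc; ++-identityʳ)
open import Data.List.Relation.Binary.Permutation.Propositional.Properties using (++-comm)
open import Data.List.Relation.Binary.Subset.Propositional.Properties using (⊆-refl; ⊆-reflexive-↭; xs⊆xs++ys)
open import Data.List.Relation.Unary.All as All using (All; []; _∷_)
open import Data.List.Relation.Unary.All.Properties using (map⁺; map⁻; anti-mono)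
open import Data.List.Relation.Unary.Any using (here)
open import Data.Nat.Base using (zero; suc)
open import Data.Product.Base using (Σ; ∃; _×_; _,_; proj₁; proj₂; swap; map₂)
open import Data.Sum.Base using (_⊎_; inj₁; inj₂)
open import Data.Sum.Properties using (inj₁-injective)
open import Function.Base using (_∘_; id)
open import Function.Bundles using (_⇔_; mk⇔)
open import Function.Definitions using (Injective)
open import Relation.Binary.PropositionalEquality.Core using (_≡_; refl; sym; subst)
open import Relation.Unary using (Pred; _⊆_; _≐_; _∪_; ｛_｝)

All-range⇒map : ∀ {a b} {A : Set a} {B : Set b} (f : A → B) {F : List B} →
  All (λ b → ∃ λ a → f a ≡ b) F → ∃ λ X → map f X ≡ F
All-range⇒map f []               = [] , refl
All-range⇒map f ((a , refl) ∷ p) with X , refl ← All-range⇒map f p = a ∷ X , refl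

-- `Q` is independent of the element, so a single instance of it settles the whole list; otherwise
-- every element satisfies `P`.
All-⊎ : ∀ {a p q} {A : Set a} {P : Pred A p} {Q : Set q} {F : List A} →
  All (λ a → P a ⊎ Q) F → All P F ⊎ Q
All-⊎ []           = inj₁ []
All-⊎ (inj₂ q ∷ _) = inj₂ q
All-⊎ (inj₁ p ∷ r) with All-⊎ r
... | inj₁ ps = inj₁ (p ∷ ps)
... | inj₂ q  = inj₂ q

module Consequence {ℓ} (N : NonmonotonicSystem ℓ) (cumulative : Cumulative N) where
  open NonmonotonicSystem N

  ∣~-elements : ∀ {X Y} → X ∣~ Y → All (λ a → X ∣~ [ a ]) Y
  ∣~-elements {X} {Y} X∣~Y = All.tabulate λ a∈Y →
    ∣~-cut X∣~Y (∣~-refl con-Y++X λ { (here refl) → xs⊆xs++ys Y X a∈Y })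
    where
    con-Y++X : Con (Y ++ X)
    con-Y++X = con-⊆ (⊆-reflexive-↭ (++-comm Y X)) (∣~-∪-con X∣~Y)

  ∣~-collect : ∀ {X Y} → Con X → All (λ a → X ∣~ [ a ]) Y → X ∣~ Y
  ∣~-collect con []       = ∣~-refl con λ ()
  ∣~-collect con (p ∷ ps) = ∣~-∪ p (∣~-collect con ps)

  ∣~-cautious : ∀ {X b} Y → X ∣~ Y → X ∣~ [ b ] → X ++ Y ∣~ [ b ]
  ∣~-cautious {X} {b} Y X∣~Y = go Y (∣~-elements X∣~Y)
    where
    go : ∀ {X} Y → All (λ a → X ∣~ [ a ]) Y → X ∣~ [ b ] → X ++ Y ∣~ [ b ]
    go {X} [] [] q = subst (_∣~ [ b ]) (sym (++-identityʳ X)) q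
    -- Adding `y` must keep the rest of `Y` derivable, so `cumulative` is applied to those premises
    -- as well as to the goal.
    go {X} (y ∷ Y) (p ∷ ps) q =
      subst (_∣~ [ b ]) (++-assoc X [ y ] Y) (go Y (All.map (cumulative p) ps) (cumulative p q))

  infix 4 _∼_
  _∼_ : List A → List A → Set ℓ
  Z ∼ W = Z ∣~ W × W ∣~ Z

  -- Cautious monotony turns `Z ∣~ [ b ]` into `Z ++ W ∣~ [ b ]`, and cut along `W ∣~ Z` then
  -- removes `Z`.
  ∼-transfer : ∀ {Z W Y} → Z ∼ W → Z ∣~ Y → W ∣~ Y
  ∼-transfer {W = W} (Z∣~W , W∣~Z) Z∣~Y = ∣~-collect (proj₁ (∣~-con W∣~Z))
    (All.map (∣~-cut W∣~Z ∘ ∣~-cautious W Z∣~W) (∣~-elements Z∣~Y))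

  ∼-refl : ∀ {Z} → Con Z → Z ∼ Z
  ∼-refl con = ∣~-refl con ⊆-refl , ∣~-refl con ⊆-refl

  ∼-trans : ∀ {Z W V} → Z ∼ W → W ∼ V → Z ∼ V
  ∼-trans Z∼W W∼V = ∼-transfer (swap Z∼W) (proj₁ W∼V) , ∼-transfer W∼V (proj₂ Z∼W)

module Construction {ℓ} (N : NonmonotonicSystem ℓ) (cumulative : Cumulative N)
                    (nonempty : ∃ (NonmonotonicSystem.Con N)) where
  open NonmonotonicSystem N
  open Consequence N cumulative

  State : Set ℓ
  State = ∃ Con

  Token : Set ℓ
  Token = A ⊎ State

  ι : A → Token
  ι = inj₁

  pattern ⟨_⟩ Z = inj₂ Z

  E : State → Pred Token ℓ
  E (Z , _) (inj₁ a)     = Z ∣~ [ a ]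
  E (Z , _) ⟨ (W , _) ⟩  = Z ∼ W

  data Default : List Token → Token → Set ℓ where
    intro : ∀ Z → Default (map ι (proj₁ Z)) ⟨ Z ⟩
    elim  : ∀ Z {b} → E Z b → Default [ ⟨ Z ⟩ ] b

  E-self : ∀ Z → E Z ⟨ Z ⟩
  E-self (_ , con) = ∼-refl con

  E-resp : ∀ Z W b → E Z ⟨ W ⟩ → E Z b → E W b
  E-resp Z W (inj₁ a) Z∼W p = ∼-transfer Z∼W p
  E-resp Z W ⟨ V ⟩    Z∼W p = ∼-trans (swap Z∼W) p

  E-map⁺ : ∀ Z {Y} → proj₁ Z ∣~ Y → All (E Z) (map ι Y)
  E-map⁺ Z = map⁺ ∘ ∣~-elements

  E-map⁻ : ∀ Z {Y} → All (E Z) (map ι Y) → proj₁ Z ∣~ Y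
  E-map⁻ (_ , con) = ∣~-collect con ∘ map⁻

  E-map-self : ∀ Z → All (E Z) (map ι (proj₁ Z))
  E-map-self Z = E-map⁺ Z (proj₁ (E-self Z))

  structure : NormalDefaultStructure ℓ
  structure = record
    { B        = Token
    ; Con*     = λ F → ∃ λ Z → All (E Z) F
    ; Δ        = Default
    ; con*-∅   = nonempty , []
    ; con*-⊆   = λ X⊆Y → map₂ (anti-mono X⊆Y)
    ; con*-[_] = λ
        { (inj₁ a) → ([ a ] , con-[ a ]) , ∣~-refl con-[ a ] ⊆-refl ∷ []
        ; ⟨ Z ⟩    → Z , E-self Z ∷ [] }
    ; Δ-con*   = λ
        { (intro Z)  → Z , E-map-self Z
        ; (elim Z _) → Z , E-self Z ∷ [] }
    }

  open NormalDefaultStructure structure hiding (B; Δ)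

  con*-map⁻ : ∀ {X} → Con* (map ι X) → Con X
  con*-map⁻ (Z , p) = proj₂ (∣~-con (E-map⁻ Z p))

  -- The pair of `⟨ Z ⟩` and `b` lies in some `E W`; then `W ∼ Z`, so `E W` and `E Z` agree.
  consistent⇒⊆E : ∀ {x Z} → Consistent x → x ⟨ Z ⟩ → x ⊆ E Z
  consistent⇒⊆E {Z = Z} con ⟨Z⟩∈x {b} b∈x with W , W∼Z ∷ b∈EW ∷ [] ← con _ (⟨Z⟩∈x ∷ b∈x ∷ []) =
    E-resp W Z b W∼Z b∈EW

  ⊆E⇒consistent : ∀ {x} Z → x ⊆ E Z → Consistent x
  ⊆E⇒consistent Z x⊆EZ F p = Z , All.map x⊆EZ p

  Generates : Pred Token ℓ → State → Set ℓ
  Generates x Z = All x (map ι (proj₁ Z)) ⊎ x ⟨ Z ⟩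

  ext : Pred Token ℓ → Pred Token ℓ
  ext x = x ∪ λ b → ∃ λ Z → Generates x Z × x ⊆ E Z × E Z b

  generates⇒∣~ : ∀ {x} Z {W} → x ⊆ E Z → Generates x W → proj₁ Z ∣~ proj₁ W
  generates⇒∣~ Z x⊆EZ (inj₁ W⊆x)   = E-map⁻ Z (All.map x⊆EZ W⊆x)
  generates⇒∣~ Z x⊆EZ (inj₂ ⟨W⟩∈x) = proj₁ (x⊆EZ ⟨W⟩∈x)

  -- Two generators of `x` whose `E` contains `x` derive each other, so all the sets joined to `x`
  -- in `ext x` coincide.
  ext⊆E : ∀ {x} Z → Generates x Z → x ⊆ E Z → ext x ⊆ E Z
  ext⊆E Z gen x⊆EZ (inj₁ b∈x) = x⊆EZ b∈x
  ext⊆E Z gen x⊆EZ {b} (inj₂ (W , genW , x⊆EW , b∈EW)) =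
    E-resp W Z b (generates⇒∣~ W x⊆EW gen , generates⇒∣~ Z x⊆EZ genW) b∈EW

  -- Stated for any `y` containing `x`, so that it serves both for `ext x` itself and for an
  -- arbitrary extension.
  φ⊆ext : ∀ {x y} → Consistent x → x ⊆ y → ∀ i → φ x y i ⊆ ext x
  φ⊆ext con x⊆y zero    b∈x        = inj₁ b∈x
  φ⊆ext con x⊆y (suc i) (inj₁ b∈φ) = φ⊆ext con x⊆y i b∈φ
  φ⊆ext {x} con x⊆y (suc i) (inj₂ (_ , intro Z , Z⊆φ , con-y)) = cases (All-⊎ (All.map splitExt Z⊆φ))
    where
    -- The justification of the default `intro Z` forces `y`, and with it `x`, into `E Z`.
    x⊆EZ : x ⊆ E Z
    x⊆EZ = consistent⇒⊆E con-y (inj₁ refl) ∘ inj₂ ∘ x⊆y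

    splitExt : ∀ {b} → φ x _ i b → x b ⊎ (∃ λ W → Generates x W × x ⊆ E W)
    splitExt b∈φ with φ⊆ext con x⊆y i b∈φ
    ... | inj₁ b∈x                   = inj₁ b∈x
    ... | inj₂ (W , gen , x⊆EW , _)  = inj₂ (W , gen , x⊆EW)

    cases : All x (map ι (proj₁ Z)) ⊎ (∃ λ W → Generates x W × x ⊆ E W) → ext x ⟨ Z ⟩
    cases (inj₁ Z⊆x)              = inj₂ (Z , inj₁ Z⊆x , x⊆EZ , E-self Z)
    -- The earlier stage lies in `E W`, whence `W ∣~ Z`; the converse comes from `x ⊆ E Z`. So
    -- `⟨ Z ⟩` is in `E W`.
    cases (inj₂ (W , gen , x⊆EW)) = inj₂ (W , gen , x⊆EW ,
      E-map⁻ W (All.map (ext⊆E W gen x⊆EW ∘ φ⊆ext con x⊆y i) Z⊆φ) , generates⇒∣~ Z x⊆EZ gen)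
  φ⊆ext con x⊆y (suc i) {b} (inj₂ (_ , elim Z b∈EZ , ⟨Z⟩∈φ ∷ [] , _)) with φ⊆ext con x⊆y i ⟨Z⟩∈φ
  ... | inj₁ ⟨Z⟩∈x                   = inj₂ (Z , inj₂ ⟨Z⟩∈x , consistent⇒⊆E con ⟨Z⟩∈x , b∈EZ)
  ... | inj₂ (W , gen , x⊆EW , W∼Z)  = inj₂ (W , gen , x⊆EW , E-resp Z W b (swap W∼Z) b∈EZ)

  ext⊆Φ : ∀ {x y} → y ⊆ ext x → ext x ⊆ Φ x y
  ext⊆Φ y⊆ext (inj₁ b∈x) = 0 , b∈x
  ext⊆Φ {x} {y} y⊆ext (inj₂ (Z , gen , x⊆EZ , b∈EZ)) =
    -- Stage 1 contains `⟨ Z ⟩`, and stage 2 all of `E Z`. Nothing is blocked, since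
    -- `y ⊆ ext x ⊆ E Z`.
    2 , inj₂ (_ , elim Z b∈EZ , ⟨Z⟩∈φ₁ gen ∷ [] , compatible b∈EZ)
    where
    compatible : ∀ {b} → E Z b → Consistent (｛ b ｝ ∪ y)
    compatible b∈EZ = ⊆E⇒consistent Z λ
      { (inj₁ refl) → b∈EZ
      ; (inj₂ c∈y)  → ext⊆E Z gen x⊆EZ (y⊆ext c∈y) }

    ⟨Z⟩∈φ₁ : Generates x Z → φ x y 1 ⟨ Z ⟩
    ⟨Z⟩∈φ₁ (inj₁ Z⊆x)   = inj₂ (_ , intro Z , Z⊆x , compatible (E-self Z))
    ⟨Z⟩∈φ₁ (inj₂ ⟨Z⟩∈x) = inj₁ ⟨Z⟩∈x

  ext-isExtension : ∀ {x} → Consistent x → ext x IsExtensionOf x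
  ext-isExtension con = (λ (i , b∈φ) → φ⊆ext con inj₁ i b∈φ) , ext⊆Φ id

  ext-unique : ∀ {x} → Consistent x → ∀ y → y IsExtensionOf x → y ≐ ext x
  ext-unique {x} con y (Φ⊆y , y⊆Φ) = y⊆ext , Φ⊆y ∘ ext⊆Φ y⊆ext
    where
    y⊆ext : y ⊆ ext x
    -- Stage 0 is `x`, so an extension contains `x` and the bound on the stages applies to it.
    y⊆ext b∈y with i , b∈φ ← y⊆Φ b∈y = φ⊆ext con (Φ⊆y ∘ (0 ,_)) i b∈φ

  uniqueExtension : ∀ x → Consistent x → HasUniqueExtension x
  uniqueExtension x con = ext x , ext-isExtension con , ext-unique con

  map-ι⊆E : ∀ Z → ⟦ map ι (proj₁ Z) ⟧ ⊆ E Z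
  map-ι⊆E Z = All.lookup (E-map-self Z)

  map-ι-generates : ∀ Z → Generates ⟦ map ι (proj₁ Z) ⟧ Z
  map-ι-generates Z = inj₁ (All.tabulate id)

  -- The state `X` generates `map ι X`, whose only extension is therefore `E` of that state.
  ∣~⇔∣~ᴮ : ∀ X Y → Con X → Con Y → (X ∣~ Y) ⇔ (map ι X ∣~ᴮ map ι Y)
  ∣~⇔∣~ᴮ X Y con-X _ = mk⇔ to from
    where
    Z : State
    Z = X , con-X

    consistent : Consistent ⟦ map ι X ⟧
    consistent = ⊆E⇒consistent Z (map-ι⊆E Z)

    to : X ∣~ Y → map ι X ∣~ᴮ map ι Y
    to X∣~Y = (Z , E-map-self Z) , λ y isExt →
      All.map (λ b∈EZ → proj₂ (ext-unique consistent y isExt)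
                          (inj₂ (Z , map-ι-generates Z , map-ι⊆E Z , b∈EZ)))
              (E-map⁺ Z X∣~Y)

    from : map ι X ∣~ᴮ map ι Y → X ∣~ Y
    from (_ , skeptical) = E-map⁻ Z
      (All.map (ext⊆E Z (map-ι-generates Z) (map-ι⊆E Z))
               (skeptical (ext ⟦ map ι X ⟧) (ext-isExtension consistent)))

  con⇔con* : ∀ (X : Pred Token ℓ) →
    (∃ λ X′ → Con X′ × X ≐ ⟦ map ι X′ ⟧)
      ⇔ (X ⊆ (λ b → ∃ λ a → ι a ≡ b) × X belongsTo Con*)
  con⇔con* X = mk⇔ to from
    where
    to : (∃ λ X′ → Con X′ × X ≐ ⟦ map ι X′ ⟧) → X ⊆ (λ b → ∃ λ a → ι a ≡ b) × X belongsTo Con*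
    to (X′ , con , X⊆ , ⊆X) = range , map ι X′ , (Z , E-map-self Z) , X⊆ , ⊆X
      where
      Z : State
      Z = X′ , con

      range : X ⊆ (λ b → ∃ λ a → ι a ≡ b)
      range b∈X with a , _ , refl ← ∈-map⁻ ι (X⊆ b∈X) = a , refl

    from : X ⊆ (λ b → ∃ λ a → ι a ≡ b) × X belongsTo Con* → ∃ λ X′ → Con X′ × X ≐ ⟦ map ι X′ ⟧
    from (range , F , con , X⊆ , ⊆X)
      with X′ , refl ← All-range⇒map ι (All.tabulate (range ∘ ⊆X)) = X′ , con*-map⁻ con , X⊆ , ⊆X

theorem7 : ∀ {ℓ} (N : NonmonotonicSystem ℓ) → Cumulative N →
    let open NonmonotonicSystem N in
    -- Con is nonempty; automatic unless A is empty, and necessary since ∅ ∈ Con*.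
    ∃ Con →
    Σ (NormalDefaultStructure ℓ) λ D →
    let open NormalDefaultStructure D in
    Σ (A → B) λ ι →
      Injective _≡_ _≡_ ι
      × (∀ (X : Pred B ℓ) →
           (∃ λ X′ → Con X′ × X ≐ ⟦ map ι X′ ⟧)
             ⇔ (X ⊆ (λ b → ∃ λ a → ι a ≡ b) × X belongsTo Con*))
      × (∀ X Y → Con X → Con Y → (X ∣~ Y) ⇔ (map ι X ∣~ᴮ map ι Y))
      × (∀ (x : Pred B ℓ) → Consistent x → HasUniqueExtension x)
theorem7 N cumulative nonempty =
  structure , ι , inj₁-injective , con⇔con* , ∣~⇔∣~ᴮ , uniqueExtension
  where open Construction N cumulative nonempty
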